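{- Let $k=2K+1\geq 5$ be an odd integer and let $\mathcal C$ be the $(K-1)\times(K-1)$ matrix with entries $$\mathcal C_{s,r}=\binom{2K-2s}{2r-1}+\binom{2K-2s}{2K-2r}\qquad(1\le s,r\le K-1).$$ Then $\mathcal C$ is invertible and for all $1\le r,s\le K-1$, $$\big(\mathcal C^{ -1}\big)_{r,s}=\frac{ -2}{2s-1}\sum_{n=0}^{k-2s}\binom{k-2r-1}{k-2s-n}\binom{n+2s-2}{n}B_n=\frac{2}{2s-1}\sum_{n=0}^{k-2s}\binom{2r-1}{k-2s-n}\binom{n+2s-2}{n}B_n .$$
   Context: $B_n$ denotes the $n$th Bernoulli number, defined by $\frac{t}{e^t-1}=\sum_{n\ge0}B_n\frac{t^n}{n!}$ (so $B_0=1$, $B_1=-\tfrac12$, $B_2=\tfrac16$). Binomial coefficients $\binom{a}{m}$ with $a\ge 0$ are the usual ones, equal to $0$ when $m<0$ or $m>a$. The matrix $\mathcal C$ is the transpose of the matrix $\mathcal A$ whose $(r,s)$-entry is $\binom{2K-2s}{2r-1}+\binom{2K-2s}{2K-2r}$, the coefficient matrix appearing in Zagier's expression of double zeta values $\zeta(2r,k-2r)$ modulo $\mathbb{Q}\zeta(k)$ in terms of products $\zeta(2s)\zeta(k-2s)$. -}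

module Defs where

open import Data.Nat using (ℕ; zero; suc; _∸_) renaming (_+_ to _+ℕ_; _*_ to _*ℕ_)
open import Data.Nat.Combinatorics using (_C_)
open import Data.Fin using (Fin; toℕ)
import Data.Fin as Fin
open import Data.Vec using (Vec; []; _∷_; _∷ʳ_; lookup; last)
open import Data.Integer using (+_)
open import Data.Rational using (ℚ; 0ℚ; 1ℚ; _+_; _*_; -_; _/_)
open import Relation.Binary.PropositionalEquality using (_≡_)
import Relation.Nullary

ℕtoℚ : ℕ → ℚ
ℕtoℚ n = + n / 1

ΣF : (n : ℕ) → (Fin n → ℚ) → ℚ
ΣF zero    f = 0ℚ
ΣF (suc n) f = f Fin.zero + ΣF n (λ i → f (Fin.suc i))

Σ≤ : ℕ → (ℕ → ℚ) → ℚ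
Σ≤ zero    f = f 0
Σ≤ (suc N) f = Σ≤ N f + f (suc N)

-- Bernoulli numbers B_0 .. B_n (convention B_1 = -1/2), via the standard
-- recurrence  sum_{j=0}^{m} C(m+1,j) B_j = 0  (m ≥ 1), B_0 = 1, which is
-- equivalent to  t/(e^t - 1) = sum B_n t^n / n!.
bernVec : (n : ℕ) → Vec ℚ (suc n)
bernVec zero    = 1ℚ ∷ []
bernVec (suc n) = prev ∷ʳ next
  where
  prev : Vec ℚ (suc n)
  prev = bernVec n
  next : ℚ
  next = - ((+ 1 / (suc (suc n))) *
            ΣF (suc n) (λ i → ℕtoℚ (suc (suc n) C toℕ i) * lookup prev i))

B : ℕ → ℚ
B n = last (bernVec n)

-- index i : Fin (K ∸ 1) represents the integer toℕ i + 1 ∈ {1,…,K-1}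
idx : {m : ℕ} → Fin m → ℕ
idx i = suc (toℕ i)

Cmat : (K : ℕ) → Fin (K ∸ 1) → Fin (K ∸ 1) → ℚ
Cmat K s r = ℕtoℚ (((2 *ℕ K) ∸ (2 *ℕ idx s)) C ((2 *ℕ idx r) ∸ 1)
                 +ℕ ((2 *ℕ K) ∸ (2 *ℕ idx s)) C ((2 *ℕ K) ∸ (2 *ℕ idx r)))

-- (note 2s-1 = suc (2 * toℕ s) since s = toℕ s + 1)
-- first formula: -2/(2s-1) Σ_{n=0}^{k-2s} binom(k-2r-1, k-2s-n) binom(n+2s-2, n) B_n, k = 2K+1
Dmat₁ : (K : ℕ) → Fin (K ∸ 1) → Fin (K ∸ 1) → ℚ
Dmat₁ K r s =
  ((Data.Integer.- (+ 2)) / suc (2 *ℕ toℕ s)) *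
  Σ≤ (k ∸ (2 *ℕ idx s)) (λ n →
     ℕtoℚ ((k ∸ (2 *ℕ idx r) ∸ 1) C (k ∸ (2 *ℕ idx s) ∸ n)) *
     ℕtoℚ ((n +ℕ (2 *ℕ idx s) ∸ 2) C n) * B n)
  where k = suc (2 *ℕ K)

Dmat₂ : (K : ℕ) → Fin (K ∸ 1) → Fin (K ∸ 1) → ℚ
Dmat₂ K r s =
  ((+ 2) / suc (2 *ℕ toℕ s)) *
  Σ≤ (k ∸ (2 *ℕ idx s)) (λ n →
     ℕtoℚ (((2 *ℕ idx r) ∸ 1) C (k ∸ (2 *ℕ idx s) ∸ n)) *
     ℕtoℚ ((n +ℕ (2 *ℕ idx s) ∸ 2) C n) * B n)
  where k = suc (2 *ℕ K)

_⊗_ : {m : ℕ} → (Fin m → Fin m → ℚ) → (Fin m → Fin m → ℚ) → Fin m → Fin m → ℚ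
_⊗_ {m} M N i j = ΣF m (λ l → M i l * N l j)

Id : {m : ℕ} → Fin m → Fin m → ℚ
Id i j with i Fin.≟ j
... | Relation.Nullary.yes _ = 1ℚ
... | Relation.Nullary.no _  = 0ℚ

{-# OPTIONS --safe #-}
-- In umbral notation put F(a) = [t^M] (1+t)^a (1-𝐁t)^{-(2s-1)} with M = k-2s, so
-- that the two formulas for the inverse are -2/(2s-1) F(2K-2r) and 2/(2s-1) F(2r-1).
-- The symmetry 𝐁 ↔ -1-𝐁 and the substitution t ↦ -t/(1+t) give
-- F(a) = (-1)^M F(2K-1-a), hence their equality.  It also turns the (s′,s) entry of
-- the product with 𝒞 into -2/(2s-1) Σ_{a>0} (-1)^a C(N,a) F(a), N = 2K-2s′.  This is
-- an N-th finite difference, so up to sign it extracts C(n+2s-2,n) B_n at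
-- n = M-N = 2(s′-s)+1, which vanishes unless n = 1
-- (for n < 0 nothing is extracted).  The a = 0 term is a multiple of
-- B_M = 0.  A one-sided inverse of a square matrix over a field is two-sided.
module Submission where

open import Defs
open import Data.Nat as ℕ using (ℕ; zero; suc; _≤_; z≤n; s≤s; _∸_; _!) renaming (_+_ to _+ℕ_; _*_ to _*ℕ_)
import Data.Nat.Properties as ℕₚ
open import Data.Nat.Combinatorics using (_C_; nCk+nC[k+1]≡[n+1]C[k+1]; k>n⇒nCk≡0; nCn≡1; nC1≡n; nCk≡nC[n∸k]; nCk≡n!/k![n-k]!; k![n∸k]!∣n!)
open import Data.Nat.DivMod using (m/n*n≡m)
open import Data.Nat.Tactic.RingSolver using () renaming (solve-∀ to ℕ-solve-∀)
open import Data.Fin as Fin using (Fin; toℕ; punchIn; punchOut)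
import Data.Fin.Properties as Finₚ
open import Data.Vec using (Vec; []; _∷_; _∷ʳ_; lookup)
open import Data.Vec.Properties using (last-∷ʳ)
import Data.Integer as ℤ
import Data.Integer.Properties as ℤₚ
open import Data.Rational using (ℚ; 0ℚ; 1ℚ; _+_; _*_; -_; _-_; _/_; 1/_; NonZero; ≢-nonZero)
open import Data.Rational.Properties
import Data.Rational.Unnormalised as ℚᵘ
import Data.Rational.Unnormalised.Properties as ℚᵘₚ
open import Data.Maybe using (Maybe; just; nothing)
open import Data.Product using (_×_; _,_; ∃; proj₁; proj₂)
open import Data.Sum using (_⊎_; inj₁; inj₂; [_,_]′)
open import Function using (_∘_)
open import Level using (0ℓ)
open import Relation.Nullary using (Dec; yes; no; contradiction)
open import Relation.Binary.Definitions using (tri<; tri≈; tri>)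
open import Relation.Binary.PropositionalEquality
open import Tactic.RingSolver using (solve-∀)
open import Tactic.RingSolver.Core.AlmostCommutativeRing using (AlmostCommutativeRing; fromCommutativeRing)
open ≡-Reasoning

ℚ-ring : AlmostCommutativeRing 0ℓ 0ℓ
ℚ-ring = fromCommutativeRing +-*-commutativeRing isZero?
  where
  isZero? : (x : ℚ) → Maybe (0ℚ ≡ x)
  isZero? x with 0ℚ ≟ x
  ... | yes e = just e
  ... | no  _ = nothing

-- Linear algebra over ℚ

ΣF-cong : ∀ n {f g : Fin n → ℚ} → (∀ i → f i ≡ g i) → ΣF n f ≡ ΣF n g
ΣF-cong zero    e = refl
ΣF-cong (suc n) e = cong₂ _+_ (e Fin.zero) (ΣF-cong n (e ∘ Fin.suc))

ΣF-zero : ∀ n → ΣF n (λ _ → 0ℚ) ≡ 0ℚ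
ΣF-zero zero    = refl
ΣF-zero (suc n) = trans (+-identityˡ _) (ΣF-zero n)

ΣF-+ : ∀ n (f g : Fin n → ℚ) → ΣF n (λ i → f i + g i) ≡ ΣF n f + ΣF n g
ΣF-+ zero    f g = refl
ΣF-+ (suc n) f g =
  trans (cong ((f Fin.zero + g Fin.zero) +_) (ΣF-+ n (f ∘ Fin.suc) (g ∘ Fin.suc)))
        (interchange (f Fin.zero) (g Fin.zero) _ _)
  where
  interchange : ∀ a b c d → (a + b) + (c + d) ≡ (a + c) + (b + d)
  interchange = solve-∀ ℚ-ring

ΣF-*ˡ : ∀ n c (f : Fin n → ℚ) → ΣF n (λ i → c * f i) ≡ c * ΣF n f
ΣF-*ˡ zero    c f = sym (*-zeroʳ c)
ΣF-*ˡ (suc n) c f =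
  trans (cong ((c * f Fin.zero) +_) (ΣF-*ˡ n c (f ∘ Fin.suc))) (sym (*-distribˡ-+ c _ _))

ΣF-*ʳ : ∀ n c (f : Fin n → ℚ) → ΣF n (λ i → f i * c) ≡ ΣF n f * c
ΣF-*ʳ n c f =
  trans (ΣF-cong n (λ i → *-comm (f i) c)) (trans (ΣF-*ˡ n c f) (*-comm c _))

ΣF-comm : ∀ m n (f : Fin m → Fin n → ℚ) →
          ΣF m (λ i → ΣF n (λ j → f i j)) ≡ ΣF n (λ j → ΣF m (λ i → f i j))
ΣF-comm zero    n f = sym (ΣF-zero n)
ΣF-comm (suc m) n f =
  trans (cong (ΣF n (f Fin.zero) +_) (ΣF-comm m n (f ∘ Fin.suc)))
        (sym (ΣF-+ n (f Fin.zero) _))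

infixr 7 _·_
-- Rectangular on purpose: elimination also applies it to `tail`, a matrix without its first column.
_·_ : ∀ {m n} → (Fin m → Fin n → ℚ) → (Fin n → ℚ) → Fin m → ℚ
_·_ {n = n} A x i = ΣF n (λ j → A i j * x j)

⊗-· : ∀ {n} (A A′ : Fin n → Fin n → ℚ) x i → ((A ⊗ A′) · x) i ≡ (A · (A′ · x)) i
⊗-· {n} A A′ x i = begin
  ΣF n (λ j → ΣF n (λ l → A i l * A′ l j) * x j)
    ≡⟨ ΣF-cong n (λ j → trans (sym (ΣF-*ʳ n (x j) _)) (ΣF-cong n (λ l → *-assoc (A i l) (A′ l j) (x j)))) ⟩
  ΣF n (λ j → ΣF n (λ l → A i l * (A′ l j * x j)))
    ≡⟨ ΣF-comm n n _ ⟩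
  ΣF n (λ l → ΣF n (λ j → A i l * (A′ l j * x j)))
    ≡⟨ ΣF-cong n (λ l → ΣF-*ˡ n (A i l) _) ⟩
  ΣF n (λ l → A i l * ΣF n (λ j → A′ l j * x j)) ∎

Id-suc : ∀ {n} (i j : Fin n) → Id (Fin.suc i) (Fin.suc j) ≡ Id i j
Id-suc i j with i Fin.≟ j
... | yes _ = refl
... | no  _ = refl

Id-diagonal : ∀ {n} (i : Fin n) → Id i i ≡ 1ℚ
Id-diagonal i with i Fin.≟ i
... | yes _   = refl
... | no  i≢i = contradiction refl i≢i

Id-off-diagonal : ∀ {n} {i j : Fin n} → i ≢ j → Id i j ≡ 0ℚ
Id-off-diagonal {i = i} {j} i≢j with i Fin.≟ j
... | yes i≡j = contradiction i≡j i≢j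
... | no  _   = refl

Id-· : ∀ {n} (x : Fin n → ℚ) i → (Id · x) i ≡ x i
Id-· {suc n} x Fin.zero = begin
  1ℚ * x Fin.zero + ΣF n (λ j → 0ℚ * x (Fin.suc j))
    ≡⟨ cong₂ _+_ (*-identityˡ (x Fin.zero)) (trans (ΣF-*ˡ n 0ℚ _) (*-zeroˡ (ΣF n (x ∘ Fin.suc)))) ⟩
  x Fin.zero + 0ℚ ≡⟨ +-identityʳ _ ⟩
  x Fin.zero ∎
Id-· {suc n} x (Fin.suc i) = begin
  0ℚ * x Fin.zero + ΣF n (λ j → Id (Fin.suc i) (Fin.suc j) * x (Fin.suc j))
    ≡⟨ cong₂ _+_ (*-zeroˡ (x Fin.zero)) (ΣF-cong n (λ j → cong (_* x (Fin.suc j)) (Id-suc i j))) ⟩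
  0ℚ + (Id · (x ∘ Fin.suc)) i ≡⟨ +-identityˡ _ ⟩
  (Id · (x ∘ Fin.suc)) i ≡⟨ Id-· (x ∘ Fin.suc) i ⟩
  x (Fin.suc i) ∎

-- The induction removes the first column of `A` and keeps all its rows, which is why `A` is
-- rectangular here.
·-Id : ∀ {m n} (A : Fin m → Fin n → ℚ) i j → (A · (λ l → Id l j)) i ≡ A i j
·-Id {n = suc n} A i Fin.zero = begin
  A i Fin.zero * 1ℚ + ΣF n (λ l → A i (Fin.suc l) * 0ℚ)
    ≡⟨ cong₂ _+_ (*-identityʳ (A i Fin.zero)) (trans (ΣF-*ʳ n 0ℚ _) (*-zeroʳ (ΣF n (A i ∘ Fin.suc)))) ⟩
  A i Fin.zero + 0ℚ ≡⟨ +-identityʳ _ ⟩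
  A i Fin.zero ∎
·-Id {n = suc n} A i (Fin.suc j) = begin
  A i Fin.zero * 0ℚ + ΣF n (λ l → A i (Fin.suc l) * Id (Fin.suc l) (Fin.suc j))
    ≡⟨ cong₂ _+_ (*-zeroʳ (A i Fin.zero)) (ΣF-cong n (λ l → cong (A i (Fin.suc l) *_) (Id-suc l j))) ⟩
  0ℚ + ((λ i′ → A i′ ∘ Fin.suc) · (λ l → Id l j)) i ≡⟨ +-identityˡ _ ⟩
  ((λ i′ → A i′ ∘ Fin.suc) · (λ l → Id l j)) i ≡⟨ ·-Id (λ i′ → A i′ ∘ Fin.suc) i j ⟩
  A i (Fin.suc j) ∎

-- One step of Gaussian elimination. The rows other than the pivot row `p` are enumerated by
-- `punchIn p`, so no rows are swapped; `schur` is what remains of them once the first column is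
-- cleared.
module Elimination {n} (A : Fin (suc n) → Fin (suc n) → ℚ) (p : Fin (suc n))
                   (pivot≢0 : A p Fin.zero ≢ 0ℚ) where

  private instance
    pivot-nonZero : NonZero (A p Fin.zero)
    pivot-nonZero = ≢-nonZero pivot≢0

  pivot⁻¹ : ℚ
  pivot⁻¹ = 1/ A p Fin.zero

  factor : Fin (suc n) → ℚ
  factor i = A i Fin.zero * pivot⁻¹

  tail : Fin (suc n) → Fin n → ℚ
  tail i = A i ∘ Fin.suc

  schur : Fin n → Fin n → ℚ
  schur i j = tail (punchIn p i) j - factor (punchIn p i) * tail p j

  schur-· : ∀ x i → (schur · x) i ≡ (tail · x) (punchIn p i) - factor (punchIn p i) * (tail · x) p
  schur-· x i = go n (tail (punchIn p i)) (tail p) x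
    where
    c = factor (punchIn p i)
    step : ∀ a b c y u v → (a - c * b) * y + (u - c * v) ≡ (a * y + u) - c * (b * y + v)
    step = solve-∀ ℚ-ring
    base : ∀ c → 0ℚ ≡ 0ℚ - c * 0ℚ
    base = solve-∀ ℚ-ring
    -- The two rows become arbitrary vectors of length `k`, so that the induction can shorten them.
    go : ∀ k (a b y : Fin k → ℚ) →
         ΣF k (λ j → (a j - c * b j) * y j) ≡ ΣF k (λ j → a j * y j) - c * ΣF k (λ j → b j * y j)
    go zero    a b y = base c
    go (suc k) a b y =
      trans (cong (((a Fin.zero - c * b Fin.zero) * y Fin.zero) +_) (go k (a ∘ Fin.suc) (b ∘ Fin.suc) (y ∘ Fin.suc)))
            (step (a Fin.zero) (b Fin.zero) c (y Fin.zero) _ _)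

  -- The first coordinate is the one that row `p` forces when its right-hand side is `y`.
  extend : ℚ → (Fin n → ℚ) → Fin (suc n) → ℚ
  extend y x Fin.zero    = pivot⁻¹ * (y - (tail · x) p)
  extend y x (Fin.suc j) = x j

  -- Row `p` holds by the choice of the first coordinate. Every other row is an equation of the
  -- reduced system plus `factor` times row `p`.
  back-substitute : ∀ (y : Fin (suc n) → ℚ) (x : Fin n → ℚ) →
    (∀ i → (schur · x) i ≡ y (punchIn p i) - factor (punchIn p i) * y p) →
    ∀ i → (A · extend (y p) x) i ≡ y i
  back-substitute y x solves i with p Fin.≟ i
  ... | yes refl = begin
    A p Fin.zero * (pivot⁻¹ * (y p - t)) + t ≡⟨ regroup (A p Fin.zero) pivot⁻¹ (y p) t ⟩
    (A p Fin.zero * pivot⁻¹) * (y p - t) + t ≡⟨ cong (λ u → u * (y p - t) + t) (*-inverseʳ (A p Fin.zero)) ⟩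
    1ℚ * (y p - t) + t                       ≡⟨ cancel (y p) t ⟩
    y p ∎
    where
    t = (tail · x) p
    regroup : ∀ a b c t → a * (b * (c - t)) + t ≡ (a * b) * (c - t) + t
    regroup = solve-∀ ℚ-ring
    cancel : ∀ c t → 1ℚ * (c - t) + t ≡ c
    cancel = solve-∀ ℚ-ring
  ... | no p≢i = subst (λ k → (A · extend (y p) x) k ≡ y k) (Finₚ.punchIn-punchOut p≢i) (begin
    A i′ Fin.zero * (pivot⁻¹ * (y p - t)) + t′ ≡⟨ regroup (A i′ Fin.zero) pivot⁻¹ (y p) t t′ ⟩
    (t′ - factor i′ * t) + factor i′ * y p     ≡⟨ cong (_+ factor i′ * y p) (trans (sym (schur-· x (punchOut p≢i))) (solves (punchOut p≢i))) ⟩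
    (y i′ - factor i′ * y p) + factor i′ * y p ≡⟨ cancel (y i′) (factor i′ * y p) ⟩
    y i′ ∎)
    where
    i′ = punchIn p (punchOut p≢i)
    t  = (tail · x) p
    t′ = (tail · x) i′
    regroup : ∀ a b c t t′ → a * (b * (c - t)) + t′ ≡ (t′ - (a * b) * t) + (a * b) * c
    regroup = solve-∀ ℚ-ring
    cancel : ∀ c d → (c - d) + d ≡ c
    cancel = solve-∀ ℚ-ring

Injective Surjective : ∀ {n} → (Fin n → Fin n → ℚ) → Set
Injective  {n} A = ∀ (x : Fin n → ℚ) → (∀ i → (A · x) i ≡ 0ℚ) → ∀ j → x j ≡ 0ℚ
Surjective {n} A = ∀ (y : Fin n → ℚ) → ∃ λ x → ∀ i → (A · x) i ≡ y i

-- Induction on the size. A kernel vector of `schur` extends to a kernel vector of `A`, so `schur`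
-- inherits injectivity; a solution of the reduced system then extends to a solution for `y`.
injective⇒surjective : ∀ n (A : Fin n → Fin n → ℚ) → Injective A → Surjective A
injective⇒surjective zero    A inj y = y , λ ()
injective⇒surjective (suc n) A inj y with Finₚ.all? (λ i → A i Fin.zero ≟ 0ℚ)
-- A zero first column puts the first unit vector in the kernel, and injectivity would give 1 = 0.
... | yes column≡0 = contradiction
  (inj (λ l → Id l Fin.zero) (λ i → trans (·-Id A i Fin.zero) (column≡0 i)) Fin.zero) 1≢0
... | no column≢0 with Finₚ.¬∀⟶∃¬ (suc n) _ (λ i → A i Fin.zero ≟ 0ℚ) column≢0
...   | p , pivot≢0 = extend (y p) (proj₁ solution) , back-substitute y _ (proj₂ solution)
  where
  open Elimination A p pivot≢0
  zero-sub : ∀ c → 0ℚ ≡ 0ℚ - c * 0ℚ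
  zero-sub = solve-∀ ℚ-ring
  schur-injective : Injective schur
  schur-injective x e j =
    inj (extend 0ℚ x) (back-substitute (λ _ → 0ℚ) x (λ i → trans (e i) (zero-sub (factor (punchIn p i))))) (Fin.suc j)
  solution = injective⇒surjective n schur schur-injective (λ i → y (punchIn p i) - factor (punchIn p i) * y p)

-- `A A′ = Id` makes `A′` injective, hence surjective, so each unit vector is `e = A′ x`. Then
-- `A′ A e = A′ (A A′) x = A′ x = e`.
leftInverse⇒rightInverse : ∀ {n} (A A′ : Fin n → Fin n → ℚ) →
  (∀ i j → (A ⊗ A′) i j ≡ Id i j) → ∀ i j → (A′ ⊗ A) i j ≡ Id i j
leftInverse⇒rightInverse {n} A A′ AA′≡Id i j = begin
  (A′ ⊗ A) i j                  ≡⟨ ·-Id (A′ ⊗ A) i j ⟨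
  ((A′ ⊗ A) · e) i              ≡⟨ ⊗-· A′ A e i ⟩
  (A′ · (A · e)) i              ≡⟨ ·-cong A′ (·-cong A (sym ∘ A′x≡e)) i ⟩
  (A′ · (A · (A′ · x))) i       ≡⟨ ·-cong A′ (retract x) i ⟩
  (A′ · x) i                    ≡⟨ A′x≡e i ⟩
  e i                           ∎
  where
  ·-cong : ∀ (A : Fin n → Fin n → ℚ) {x y} → (∀ j → x j ≡ y j) → ∀ i → (A · x) i ≡ (A · y) i
  ·-cong A x≡y i = ΣF-cong n (λ j → cong (A i j *_) (x≡y j))
  retract : ∀ x i → (A · (A′ · x)) i ≡ x i
  retract x i = begin
    (A · (A′ · x)) i ≡⟨ ⊗-· A A′ x i ⟨
    ((A ⊗ A′) · x) i ≡⟨ ΣF-cong n (λ j → cong (_* x j) (AA′≡Id i j)) ⟩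
    (Id · x) i       ≡⟨ Id-· x i ⟩
    x i              ∎
  A′-injective : Injective A′
  A′-injective x A′x≡0 j = begin
    x j                    ≡⟨ retract x j ⟨
    (A · (A′ · x)) j       ≡⟨ ·-cong A A′x≡0 j ⟩
    (A · (λ _ → 0ℚ)) j     ≡⟨ ΣF-*ʳ n 0ℚ (A j) ⟩
    ΣF n (A j) * 0ℚ        ≡⟨ *-zeroʳ (ΣF n (A j)) ⟩
    0ℚ                     ∎
  e : Fin n → ℚ
  e l = Id l j
  x = proj₁ (injective⇒surjective n A′ A′-injective e)
  A′x≡e = proj₂ (injective⇒surjective n A′ A′-injective e)

-- Rational arithmetic and binomial coefficients

-- `_/_` divides by a gcd and does not compute on variables. The identity is therefore checked on
-- unnormalised rationals, where it is integer arithmetic; `ℕtoℚ-+` and `ℕtoℚ-*` go the same way.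
/-*-cancel : ∀ a d → (ℤ.+ a / suc d) * ℕtoℚ (suc d) ≡ ℕtoℚ a
/-*-cancel a d = toℚᵘ-injective (ℚᵘₚ.≃-trans (toℚᵘ-homo-* (ℤ.+ a / suc d) (ℕtoℚ (suc d)))
  (ℚᵘₚ.≃-trans (ℚᵘₚ.*-cong (toℚᵘ-fromℚᵘ (ℚᵘ.mkℚᵘ (ℤ.+ a) d)) (toℚᵘ-fromℚᵘ (ℚᵘ.mkℚᵘ (ℤ.+ suc d) 0)))
  (ℚᵘₚ.≃-trans (ℚᵘ.*≡* e) (ℚᵘₚ.≃-sym (toℚᵘ-fromℚᵘ (ℚᵘ.mkℚᵘ (ℤ.+ a) 0))))))
  where
  e : (ℤ.+ a ℤ.* ℤ.+ suc d) ℤ.* ℤ.+ 1 ≡ ℤ.+ a ℤ.* ℤ.+ suc (d *ℕ 1)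
  e = trans (ℤₚ.*-identityʳ _) (cong (λ t → ℤ.+ a ℤ.* ℤ.+ suc t) (sym (ℕₚ.*-identityʳ d)))

ℕtoℚ-+ : ∀ m n → ℕtoℚ (m +ℕ n) ≡ ℕtoℚ m + ℕtoℚ n
ℕtoℚ-+ m n = toℚᵘ-injective (ℚᵘₚ.≃-trans (toℚᵘ-fromℚᵘ (ℚᵘ.mkℚᵘ (ℤ.+ (m +ℕ n)) 0))
  (ℚᵘₚ.≃-trans (ℚᵘ.*≡* e) (ℚᵘₚ.≃-sym (ℚᵘₚ.≃-trans (toℚᵘ-homo-+ (ℕtoℚ m) (ℕtoℚ n))
  (ℚᵘₚ.+-cong (toℚᵘ-fromℚᵘ (ℚᵘ.mkℚᵘ (ℤ.+ m) 0)) (toℚᵘ-fromℚᵘ (ℚᵘ.mkℚᵘ (ℤ.+ n) 0)))))))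
  where
  e : (ℤ.+ m ℤ.+ ℤ.+ n) ℤ.* ℤ.+ 1 ≡ (ℤ.+ m ℤ.* ℤ.+ 1 ℤ.+ ℤ.+ n ℤ.* ℤ.+ 1) ℤ.* ℤ.+ 1
  e = cong (ℤ._* ℤ.+ 1) (sym (cong₂ ℤ._+_ (ℤₚ.*-identityʳ (ℤ.+ m)) (ℤₚ.*-identityʳ (ℤ.+ n))))

ℕtoℚ-* : ∀ m n → ℕtoℚ (m *ℕ n) ≡ ℕtoℚ m * ℕtoℚ n
ℕtoℚ-* m n = toℚᵘ-injective (ℚᵘₚ.≃-trans (toℚᵘ-fromℚᵘ (ℚᵘ.mkℚᵘ (ℤ.+ (m *ℕ n)) 0))
  (ℚᵘₚ.≃-trans (ℚᵘ.*≡* e) (ℚᵘₚ.≃-sym (ℚᵘₚ.≃-trans (toℚᵘ-homo-* (ℕtoℚ m) (ℕtoℚ n))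
  (ℚᵘₚ.*-cong (toℚᵘ-fromℚᵘ (ℚᵘ.mkℚᵘ (ℤ.+ m) 0)) (toℚᵘ-fromℚᵘ (ℚᵘ.mkℚᵘ (ℤ.+ n) 0)))))))
  where
  e : ℤ.+ (m *ℕ n) ℤ.* ℤ.+ 1 ≡ (ℤ.+ m ℤ.* ℤ.+ n) ℤ.* ℤ.+ 1
  e = cong (ℤ._* ℤ.+ 1) (ℤₚ.pos-* m n)

*-cancelʳ-0 : ∀ n x → x * ℕtoℚ (suc n) ≡ 0ℚ → x ≡ 0ℚ
*-cancelʳ-0 n x e = begin
  x                                         ≡⟨ *-identityʳ x ⟨
  x * 1ℚ                                    ≡⟨ cong (x *_) (/-*-cancel 1 n) ⟨
  x * ((ℤ.+ 1 / suc n) * ℕtoℚ (suc n))      ≡⟨ rearrange x (ℤ.+ 1 / suc n) (ℕtoℚ (suc n)) ⟩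
  (x * ℕtoℚ (suc n)) * (ℤ.+ 1 / suc n)      ≡⟨ cong (_* (ℤ.+ 1 / suc n)) e ⟩
  0ℚ * (ℤ.+ 1 / suc n)                      ≡⟨ *-zeroˡ (ℤ.+ 1 / suc n) ⟩
  0ℚ                                        ∎
  where
  rearrange : ∀ a b c → a * (b * c) ≡ (a * c) * b
  rearrange = solve-∀ ℚ-ring

bin : ℕ → ℕ → ℚ
bin n k = ℕtoℚ (n C k)

bin-pascal : ∀ n k → bin (suc n) (suc k) ≡ bin n k + bin n (suc k)
bin-pascal n k = trans (cong ℕtoℚ (sym (nCk+nC[k+1]≡[n+1]C[k+1] n k))) (ℕtoℚ-+ (n C k) (n C suc k))

bin-n-0 : ∀ n → bin n 0 ≡ 1ℚ
bin-n-0 n = cong ℕtoℚ (trans (nCk≡nC[n∸k] (z≤n {n})) (nCn≡1 n))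

bin-n-n : ∀ n → bin n n ≡ 1ℚ
bin-n-n n = cong ℕtoℚ (nCn≡1 n)

bin-> : ∀ {n k} → n ℕ.< k → bin n k ≡ 0ℚ
bin-> n<k = cong ℕtoℚ (k>n⇒nCk≡0 n<k)

bin-[1+n]-n : ∀ n → bin (suc n) n ≡ ℕtoℚ (suc n)
bin-[1+n]-n n = cong ℕtoℚ (begin
  suc n C n             ≡⟨ nCk≡nC[n∸k] (ℕₚ.n≤1+n n) ⟩
  suc n C (suc n ∸ n)   ≡⟨ cong (suc n C_) (ℕₚ.m+n∸n≡m 1 n) ⟩
  suc n C 1             ≡⟨ nC1≡n (suc n) ⟩
  suc n                 ∎)

C-factorial : ∀ a b → ((a +ℕ b) C a) *ℕ (a ! *ℕ b !) ≡ (a +ℕ b) !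
C-factorial a b = begin
  ((a +ℕ b) C a) *ℕ (a ! *ℕ b !)
    ≡⟨ cong (λ t → ((a +ℕ b) C a) *ℕ (a ! *ℕ t !)) (ℕₚ.m+n∸m≡n a b) ⟨
  ((a +ℕ b) C a) *ℕ d
    ≡⟨ cong (_*ℕ d) (nCk≡n!/k![n-k]! a≤a+b) ⟩
  ((a +ℕ b) ! ℕ./ d) *ℕ d
    ≡⟨ m/n*n≡m (k![n∸k]!∣n! a≤a+b) ⟩
  (a +ℕ b) ! ∎
  where
  a≤a+b = ℕₚ.m≤m+n a b
  d = a ! *ℕ (a +ℕ b ∸ a) !
  instance
    d≢0 : ℕ.NonZero d
    d≢0 = ℕₚ._!*_!≢0 a (a +ℕ b ∸ a)

-- Both sides are the trinomial coefficient (n+e+p)!/(n! e! p!). Multiplying by the denominator and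
-- cancelling it afterwards avoids natural-number division.
trinomial-revision : ∀ n e p →
  ((n +ℕ e +ℕ p) C e) *ℕ ((n +ℕ p) C n) ≡ ((n +ℕ e +ℕ p) C (n +ℕ e)) *ℕ ((n +ℕ e) C n)
trinomial-revision n e p = ℕₚ.*-cancelʳ-≡ _ _ (e ! *ℕ (n ! *ℕ p !)) {{nz}} (trans lhs (sym rhs))
  where
  nz = ℕₚ.m*n≢0 (e !) (n ! *ℕ p !) {{ℕₚ._!≢0 e}} {{ℕₚ._!*_!≢0 n p}}
  swap : n +ℕ e +ℕ p ≡ e +ℕ (n +ℕ p)
  swap = trans (cong (_+ℕ p) (ℕₚ.+-comm n e)) (ℕₚ.+-assoc e n p)
  regroupˡ : ∀ X Y e n p → X *ℕ Y *ℕ (e *ℕ (n *ℕ p)) ≡ X *ℕ (e *ℕ (Y *ℕ (n *ℕ p)))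
  regroupˡ = ℕ-solve-∀
  regroupʳ : ∀ X Y e n p → X *ℕ Y *ℕ (e *ℕ (n *ℕ p)) ≡ X *ℕ ((Y *ℕ (n *ℕ e)) *ℕ p)
  regroupʳ = ℕ-solve-∀
  lhs : ((n +ℕ e +ℕ p) C e) *ℕ ((n +ℕ p) C n) *ℕ (e ! *ℕ (n ! *ℕ p !)) ≡ (n +ℕ e +ℕ p) !
  lhs = begin
    ((n +ℕ e +ℕ p) C e) *ℕ ((n +ℕ p) C n) *ℕ (e ! *ℕ (n ! *ℕ p !))
      ≡⟨ regroupˡ ((n +ℕ e +ℕ p) C e) ((n +ℕ p) C n) (e !) (n !) (p !) ⟩
    ((n +ℕ e +ℕ p) C e) *ℕ (e ! *ℕ (((n +ℕ p) C n) *ℕ (n ! *ℕ p !)))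
      ≡⟨ cong₂ (λ s t → (s C e) *ℕ (e ! *ℕ t)) swap (C-factorial n p) ⟩
    ((e +ℕ (n +ℕ p)) C e) *ℕ (e ! *ℕ (n +ℕ p) !)
      ≡⟨ C-factorial e (n +ℕ p) ⟩
    (e +ℕ (n +ℕ p)) !
      ≡⟨ cong _! swap ⟨
    (n +ℕ e +ℕ p) ! ∎
  rhs : ((n +ℕ e +ℕ p) C (n +ℕ e)) *ℕ ((n +ℕ e) C n) *ℕ (e ! *ℕ (n ! *ℕ p !)) ≡ (n +ℕ e +ℕ p) !
  rhs = begin
    ((n +ℕ e +ℕ p) C (n +ℕ e)) *ℕ ((n +ℕ e) C n) *ℕ (e ! *ℕ (n ! *ℕ p !))
      ≡⟨ regroupʳ ((n +ℕ e +ℕ p) C (n +ℕ e)) ((n +ℕ e) C n) (e !) (n !) (p !) ⟩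
    ((n +ℕ e +ℕ p) C (n +ℕ e)) *ℕ ((((n +ℕ e) C n) *ℕ (n ! *ℕ e !)) *ℕ p !)
      ≡⟨ cong (λ t → ((n +ℕ e +ℕ p) C (n +ℕ e)) *ℕ (t *ℕ p !)) (C-factorial n e) ⟩
    ((n +ℕ e +ℕ p) C (n +ℕ e)) *ℕ ((n +ℕ e) ! *ℕ p !)
      ≡⟨ C-factorial (n +ℕ e) p ⟩
    (n +ℕ e +ℕ p) ! ∎

-- Finite sums

Σ≤-cong : ∀ N {f g : ℕ → ℚ} → (∀ {i} → i ≤ N → f i ≡ g i) → Σ≤ N f ≡ Σ≤ N g
Σ≤-cong zero    e = e z≤n
Σ≤-cong (suc N) e = cong₂ _+_ (Σ≤-cong N (λ i≤N → e (ℕₚ.m≤n⇒m≤1+n i≤N))) (e ℕₚ.≤-refl)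

Σ≤-+ : ∀ N (f g : ℕ → ℚ) → Σ≤ N (λ i → f i + g i) ≡ Σ≤ N f + Σ≤ N g
Σ≤-+ zero    f g = refl
Σ≤-+ (suc N) f g = trans (cong (_+ (f (suc N) + g (suc N))) (Σ≤-+ N f g)) (interchange (Σ≤ N f) (Σ≤ N g) (f (suc N)) (g (suc N)))
  where
  interchange : ∀ a b c d → (a + b) + (c + d) ≡ (a + c) + (b + d)
  interchange = solve-∀ ℚ-ring

Σ≤-*ˡ : ∀ N c (f : ℕ → ℚ) → Σ≤ N (λ i → c * f i) ≡ c * Σ≤ N f
Σ≤-*ˡ zero    c f = refl
Σ≤-*ˡ (suc N) c f = trans (cong (_+ c * f (suc N)) (Σ≤-*ˡ N c f)) (sym (*-distribˡ-+ c _ _))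

Σ≤-zero : ∀ N {f : ℕ → ℚ} → (∀ {i} → i ≤ N → f i ≡ 0ℚ) → Σ≤ N f ≡ 0ℚ
Σ≤-zero zero    e = e z≤n
Σ≤-zero (suc N) e = cong₂ _+_ (Σ≤-zero N (λ i≤N → e (ℕₚ.m≤n⇒m≤1+n i≤N))) (e ℕₚ.≤-refl)

Σ≤-head : ∀ N (f : ℕ → ℚ) → Σ≤ (suc N) f ≡ f 0 + Σ≤ N (f ∘ suc)
Σ≤-head zero    f = refl
Σ≤-head (suc N) f = trans (cong (_+ f (suc (suc N))) (Σ≤-head N f)) (+-assoc (f 0) _ _)

Σ≤-reverse : ∀ N (f : ℕ → ℚ) → Σ≤ N (λ i → f (N ∸ i)) ≡ Σ≤ N f
Σ≤-reverse zero    f = refl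
Σ≤-reverse (suc N) f = begin
  Σ≤ (suc N) (λ i → f (suc N ∸ i))      ≡⟨ Σ≤-head N (λ i → f (suc N ∸ i)) ⟩
  f (suc N) + Σ≤ N (λ i → f (N ∸ i))    ≡⟨ cong (f (suc N) +_) (Σ≤-reverse N f) ⟩
  f (suc N) + Σ≤ N f                    ≡⟨ +-comm (f (suc N)) _ ⟩
  Σ≤ N f + f (suc N)                    ∎

Σ≤-extend : ∀ N d (f : ℕ → ℚ) → (∀ {i} → N ℕ.< i → f i ≡ 0ℚ) → Σ≤ (d +ℕ N) f ≡ Σ≤ N f
Σ≤-extend N zero    f e = refl
Σ≤-extend N (suc d) f e = trans (cong₂ _+_ (Σ≤-extend N d f e) (e (s≤s (ℕₚ.m≤n+m N d)))) (+-identityʳ _)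

ΣF≡Σ≤ : ∀ N (f : ℕ → ℚ) → ΣF (suc N) (f ∘ toℕ) ≡ Σ≤ N f
ΣF≡Σ≤ zero    f = +-identityʳ (f 0)
ΣF≡Σ≤ (suc N) f = trans (cong (f 0 +_) (ΣF≡Σ≤ N (f ∘ suc))) (sym (Σ≤-head N f))

-- Binomial transforms

sgn : ℕ → ℚ
sgn zero    = 1ℚ
sgn (suc n) = - sgn n

sgn-even : ∀ n → sgn (2 *ℕ n) ≡ 1ℚ
sgn-even zero    = refl
sgn-even (suc n) = trans (cong sgn (ℕₚ.*-suc 2 n)) (trans (neg-involutive (sgn (2 *ℕ n))) (sgn-even n))
  where
  neg-involutive : ∀ x → - (- x) ≡ x
  neg-involutive = solve-∀ ℚ-ring

signed : (ℕ → ℚ) → ℕ → ℚ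
signed f n = sgn n * f n

-- The binomial transform, umbrally gⁿ ↦ (1+g)ⁿ. Applied to `signed f` it is (-1)ⁿ times the n-th
-- finite difference of `f` at 0.
T : (ℕ → ℚ) → ℕ → ℚ
T g n = Σ≤ n (λ j → bin n j * g j)

T-cong : ∀ {f g : ℕ → ℚ} → (∀ n → f n ≡ g n) → ∀ n → T f n ≡ T g n
T-cong e n = Σ≤-cong n (λ {j} _ → cong (bin n j *_) (e j))

T-+ : ∀ (f g : ℕ → ℚ) n → T (λ j → f j + g j) n ≡ T f n + T g n
T-+ f g n = trans (Σ≤-cong n (λ {j} _ → *-distribˡ-+ (bin n j) (f j) (g j))) (Σ≤-+ n _ _)

T-neg : ∀ (f : ℕ → ℚ) n → T (λ j → - f j) n ≡ - T f n
T-neg f n = begin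
  T (λ j → - f j) n                       ≡⟨ Σ≤-cong n (λ {j} _ → pull-neg (bin n j) (f j)) ⟩
  Σ≤ n (λ j → (- 1ℚ) * (bin n j * f j))   ≡⟨ Σ≤-*ˡ n (- 1ℚ) _ ⟩
  (- 1ℚ) * T f n                          ≡⟨ neg-one (T f n) ⟩
  - T f n                                 ∎
  where
  pull-neg : ∀ a b → a * (- b) ≡ (- 1ℚ) * (a * b)
  pull-neg = solve-∀ ℚ-ring
  neg-one : ∀ a → (- 1ℚ) * a ≡ - a
  neg-one = solve-∀ ℚ-ring

-- Pascal's rule; umbrally (1+g)ⁿ⁺¹ = (1+g)ⁿ + g(1+g)ⁿ.
T-suc : ∀ g n → T g (suc n) ≡ T g n + T (g ∘ suc) n
T-suc g n = begin
  T g (suc n)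
    ≡⟨ Σ≤-head n _ ⟩
  bin (suc n) 0 * g 0 + Σ≤ n (λ j → bin (suc n) (suc j) * g (suc j))
    ≡⟨ cong₂ _+_ (cong (_* g 0) (trans (bin-n-0 (suc n)) (sym (bin-n-0 n))))
         (trans (Σ≤-cong n (λ {j} _ → trans (cong (_* g (suc j)) (bin-pascal n j)) (*-distribʳ-+ (g (suc j)) (bin n j) (bin n (suc j))))) (Σ≤-+ n _ _)) ⟩
  bin n 0 * g 0 + (T (g ∘ suc) n + Σ≤ n (λ j → bin n (suc j) * g (suc j)))
    ≡⟨ rearrange (bin n 0 * g 0) (T (g ∘ suc) n) _ ⟩
  (bin n 0 * g 0 + Σ≤ n (λ j → bin n (suc j) * g (suc j))) + T (g ∘ suc) n
    ≡⟨ cong (_+ T (g ∘ suc) n) (sym (Σ≤-head n (λ j → bin n j * g j))) ⟩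
  Σ≤ (suc n) (λ j → bin n j * g j) + T (g ∘ suc) n
    ≡⟨ cong (_+ T (g ∘ suc) n) (Σ≤-extend n 1 _ (λ {i} n<i → trans (cong (_* g i) (bin-> n<i)) (*-zeroˡ (g i)))) ⟩
  T g n + T (g ∘ suc) n ∎
  where
  rearrange : ∀ a b c → a + (b + c) ≡ (a + c) + b
  rearrange = solve-∀ ℚ-ring

-- An (n+1)-st difference of `f` is an n-th difference of its first difference `h`. The minus sign
-- comes from the alternation in `signed`.
T-signed-suc : ∀ (f h : ℕ → ℚ) → (∀ a → f (suc a) ≡ f a + h a) →
  ∀ n → T (signed f) (suc n) ≡ - T (signed h) n
T-signed-suc f h Δf≡h n = begin
  T (signed f) (suc n)
    ≡⟨ T-suc (signed f) n ⟩
  T (signed f) n + T (signed f ∘ suc) n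
    ≡⟨ T-+ (signed f) (signed f ∘ suc) n ⟨
  T (λ a → signed f a + signed f (suc a)) n
    ≡⟨ T-cong (λ a → trans (cong (λ t → sgn a * f a + (- sgn a) * t) (Δf≡h a)) (telescope (sgn a) (f a) (h a))) n ⟩
  T (λ a → - signed h a) n
    ≡⟨ T-neg (signed h) n ⟩
  - T (signed h) n ∎
  where
  telescope : ∀ s x y → s * x + (- s) * (x + y) ≡ - (s * y)
  telescope = solve-∀ ℚ-ring

-- By `T-suc` the first difference of `T g` is `T` of the shifted sequence, so the induction on `n`
-- varies `g`.
binomial-inversion : ∀ g n → T (signed (T g)) n ≡ signed g n
binomial-inversion g zero    = trans (*-identityˡ (1ℚ * T g 0)) (cong (1ℚ *_) (*-identityˡ (g 0)))
binomial-inversion g (suc n) = begin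
  T (signed (T g)) (suc n)         ≡⟨ T-signed-suc (T g) (T (g ∘ suc)) (T-suc g) n ⟩
  - T (signed (T (g ∘ suc))) n     ≡⟨ cong -_ (binomial-inversion (g ∘ suc) n) ⟩
  - (sgn n * g (suc n))            ≡⟨ neg-distribˡ-* (sgn n) (g (suc n)) ⟩
  (- sgn n) * g (suc n)            ∎

-- The top term of `T E (suc n)` is `E (suc n)` itself. Cancelling it leaves a relation among E₀,
-- ..., Eₙ in which Eₙ has the nonzero coefficient n+1; strong induction finishes.
T-fixed⇒zero : ∀ (E : ℕ → ℚ) → (∀ n → T E n ≡ E n) → ∀ n → E n ≡ 0ℚ
T-fixed⇒zero E fixed n = below n ℕₚ.≤-refl
  where
  cancel : ∀ s x → s ≡ (s + x) - x
  cancel = solve-∀ ℚ-ring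
  sum≡0 : ∀ n → Σ≤ n (λ j → bin (suc n) j * E j) ≡ 0ℚ
  sum≡0 n = begin
    s                                                   ≡⟨ cancel s (E (suc n)) ⟩
    (s + E (suc n)) - E (suc n)                         ≡⟨ cong (λ t → (s + t) - E (suc n)) (trans (cong (_* E (suc n)) (bin-n-n (suc n))) (*-identityˡ (E (suc n)))) ⟨
    T E (suc n) - E (suc n)                             ≡⟨ cong (_- E (suc n)) (fixed (suc n)) ⟩
    E (suc n) - E (suc n)                               ≡⟨ +-inverseʳ (E (suc n)) ⟩
    0ℚ                                                  ∎
    where s = Σ≤ n (λ j → bin (suc n) j * E j)
  top : ∀ n → bin (suc n) n * E n ≡ 0ℚ → E n ≡ 0ℚ
  top n e = *-cancelʳ-0 n (E n) (trans (*-comm (E n) _) (trans (cong (_* E n) (sym (bin-[1+n]-n n))) e))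
  below : ∀ n {j} → j ≤ n → E j ≡ 0ℚ
  below zero    z≤n = top 0 (sum≡0 0)
  below (suc n) {j} j≤1+n with j ℕ.≟ suc n
  ... | no  j≢1+n = below n (ℕ.s≤s⁻¹ (ℕₚ.≤∧≢⇒< j≤1+n j≢1+n))
  ... | yes refl  = top (suc n) (begin
    bin (suc (suc n)) (suc n) * E (suc n)            ≡⟨ +-identityˡ _ ⟨
    0ℚ + bin (suc (suc n)) (suc n) * E (suc n)       ≡⟨ cong (_+ bin (suc (suc n)) (suc n) * E (suc n)) (Σ≤-zero n (λ {i} i≤n → trans (cong (bin (suc (suc n)) i *_) (below n i≤n)) (*-zeroʳ (bin (suc (suc n)) i)))) ⟨
    Σ≤ (suc n) (λ j → bin (suc (suc n)) j * E j)     ≡⟨ sum≡0 (suc n) ⟩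
    0ℚ                                               ∎)

-- Bernoulli numbers

lookup-∷ʳ : ∀ {A : Set} {n} (f : ℕ → A) (xs : Vec A n) x →
  (∀ i → lookup xs i ≡ f (toℕ i)) → x ≡ f n → ∀ i → lookup (xs ∷ʳ x) i ≡ f (toℕ i)
lookup-∷ʳ f []       x e x≡fn Fin.zero    = x≡fn
lookup-∷ʳ f (y ∷ xs) x e x≡fn Fin.zero    = e Fin.zero
lookup-∷ʳ f (y ∷ xs) x e x≡fn (Fin.suc i) = lookup-∷ʳ (f ∘ suc) xs x (e ∘ Fin.suc) x≡fn i

lookup-bernVec : ∀ n i → lookup (bernVec n) i ≡ B (toℕ i)
lookup-bernVec zero    Fin.zero = refl
lookup-bernVec (suc n) i =
  lookup-∷ʳ B (bernVec n) _ (lookup-bernVec n) (sym (last-∷ʳ _ (bernVec n))) i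

B-suc : ∀ n → B (suc n) ≡ - ((ℤ.+ 1 / suc (suc n)) * Σ≤ n (λ j → bin (suc (suc n)) j * B j))
B-suc n = trans (last-∷ʳ _ (bernVec n)) (cong (λ t → - ((ℤ.+ 1 / suc (suc n)) * t)) (begin
  ΣF (suc n) (λ i → bin (suc (suc n)) (toℕ i) * lookup (bernVec n) i)
    ≡⟨ ΣF-cong (suc n) (λ i → cong (bin (suc (suc n)) (toℕ i) *_) (lookup-bernVec n i)) ⟩
  ΣF (suc n) (λ i → bin (suc (suc n)) (toℕ i) * B (toℕ i))
    ≡⟨ ΣF≡Σ≤ n (λ j → bin (suc (suc n)) j * B j) ⟩
  Σ≤ n (λ j → bin (suc (suc n)) j * B j) ∎))

δ₁ : ℕ → ℚ
δ₁ 1 = 1ℚ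
δ₁ _ = 0ℚ

-- Umbrally (1+𝐁)ⁿ = 𝐁ⁿ + [n = 1]. For n ≥ 2 the recurrence defining the preceding Bernoulli number
-- says that all terms below the top one cancel; the exception at 1 reflects B₁ = -1/2.
T-B : ∀ n → T B n ≡ B n + δ₁ n
T-B 0 = refl
T-B 1 = refl
T-B (suc (suc n)) = begin
  (X + bin (suc (suc n)) (suc n) * B (suc n)) + bin (suc (suc n)) (suc (suc n)) * B (suc (suc n))
    ≡⟨ cong₂ (λ s t → (X + s) + t) (cong₂ _*_ (bin-[1+n]-n (suc n)) (B-suc n)) (cong (_* B (suc (suc n))) (bin-n-n (suc (suc n)))) ⟩
  (X + ν * (- (ν⁻¹ * X))) + 1ℚ * B (suc (suc n))
    ≡⟨ rearrange X ν ν⁻¹ (B (suc (suc n))) ⟩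
  (X - (ν⁻¹ * ν) * X) + B (suc (suc n))
    ≡⟨ cong (λ t → (X - t * X) + B (suc (suc n))) (/-*-cancel 1 (suc n)) ⟩
  (X - 1ℚ * X) + B (suc (suc n))
    ≡⟨ cancel X (B (suc (suc n))) ⟩
  B (suc (suc n)) + 0ℚ ∎
  where
  X = Σ≤ n (λ j → bin (suc (suc n)) j * B j)
  ν = ℕtoℚ (suc (suc n))
  ν⁻¹ = ℤ.+ 1 / suc (suc n)
  rearrange : ∀ X ν μ b → (X + ν * (- (μ * X))) + 1ℚ * b ≡ (X - (μ * ν) * X) + b
  rearrange = solve-∀ ℚ-ring
  cancel : ∀ X b → (X - 1ℚ * X) + b ≡ b + 0ℚ
  cancel = solve-∀ ℚ-ring

-- Umbrally (-1-𝐁)ⁿ = 𝐁ⁿ: binomial inversion shows that the difference of the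
-- two sides is a fixed point of T, and T has no nonzero fixed point.
signed-T-B : ∀ n → signed (T B) n ≡ B n
signed-T-B n = begin
  signed (T B) n             ≡⟨ recover (signed (T B) n) (B n) ⟩
  E n + B n                  ≡⟨ cong (_+ B n) (T-fixed⇒zero E E-fixed n) ⟩
  0ℚ + B n                   ≡⟨ +-identityˡ (B n) ⟩
  B n                        ∎
  where
  recover : ∀ x y → x ≡ (x - y) + y
  recover = solve-∀ ℚ-ring
  E : ℕ → ℚ
  E n = signed (T B) n - B n
  rearrange : ∀ s b d → s * b - (b + d) ≡ s * b + (- d) - b
  rearrange = solve-∀ ℚ-ring
  -- At 1, the only index where `δ₁` is nonzero, the sign is -1. This is what lets the correction
  -- term in `T-B` reassemble into `signed (T B)`.
  signed-δ₁ : ∀ n → - δ₁ n ≡ sgn n * δ₁ n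
  signed-δ₁ 0 = refl
  signed-δ₁ 1 = refl
  signed-δ₁ (suc (suc n)) = sym (*-zeroʳ (sgn (suc (suc n))))
  E-fixed : ∀ n → T E n ≡ E n
  E-fixed n = begin
    T E n
      ≡⟨ T-+ (signed (T B)) (λ j → - B j) n ⟩
    T (signed (T B)) n + T (λ j → - B j) n
      ≡⟨ cong₂ _+_ (binomial-inversion B n) (T-neg B n) ⟩
    sgn n * B n - T B n
      ≡⟨ cong (λ t → sgn n * B n - t) (T-B n) ⟩
    sgn n * B n - (B n + δ₁ n)
      ≡⟨ rearrange (sgn n) (B n) (δ₁ n) ⟩
    sgn n * B n + (- δ₁ n) - B n
      ≡⟨ cong (λ t → sgn n * B n + t - B n) (signed-δ₁ n) ⟩
    sgn n * B n + sgn n * δ₁ n - B n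
      ≡⟨ cong (_- B n) (*-distribˡ-+ (sgn n) (B n) (δ₁ n)) ⟨
    sgn n * (B n + δ₁ n) - B n
      ≡⟨ cong (λ t → sgn n * t - B n) (T-B n) ⟨
    E n ∎

sgn-odd : ∀ n → sgn (suc (2 *ℕ n)) ≡ - 1ℚ
sgn-odd n = cong -_ (sgn-even n)

-- At an odd index above 1 the correction `δ₁` vanishes, so the symmetry `signed-T-B` reads b = -b.
B-odd : ∀ n → B (suc (2 *ℕ suc n)) ≡ 0ℚ
B-odd n = *-cancelʳ-0 1 b (begin
  b * ℕtoℚ 2                   ≡⟨ double b ⟩
  b + b                        ≡⟨ cong (b +_) (signed-T-B m) ⟨
  b + sgn m * T B m            ≡⟨ cong₂ (λ s t → b + s * t) (sgn-odd (suc n)) (trans (T-B m) (cong (b +_) δ₁m≡0)) ⟩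
  b + (- 1ℚ) * (b + 0ℚ)        ≡⟨ cancel b ⟩
  0ℚ                           ∎)
  where
  m = suc (2 *ℕ suc n)
  b = B m
  δ₁m≡0 : δ₁ m ≡ 0ℚ
  δ₁m≡0 = cong (δ₁ ∘ suc) (ℕₚ.*-suc 2 n)
  double : ∀ b → b * (1ℚ + 1ℚ) ≡ b + b
  double = solve-∀ ℚ-ring
  cancel : ∀ b → b + (- 1ℚ) * (b + 0ℚ) ≡ 0ℚ
  cancel = solve-∀ ℚ-ring

-- Coefficients of (1 + t)ᵃ Σ cₙ tⁿ

conv : (ℕ → ℚ) → ℕ → ℕ → ℚ
conv c M a = Σ≤ M (λ n → bin a (M ∸ n) * c n)

conv-0 : ∀ c M → conv c M 0 ≡ c M
conv-0 c zero    = *-identityˡ (c 0)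
conv-0 c (suc M) = begin
  Σ≤ M (λ n → bin 0 (suc M ∸ n) * c n) + bin 0 (M ∸ M) * c (suc M)
    ≡⟨ cong₂ _+_ (Σ≤-zero M (λ {n} n≤M → trans (cong (_* c n) (bin-> (ℕₚ.m<n⇒0<n∸m (s≤s n≤M)))) (*-zeroˡ (c n))))
                 (cong (λ t → bin 0 t * c (suc M)) (ℕₚ.n∸n≡0 M)) ⟩
  0ℚ + 1ℚ * c (suc M)
    ≡⟨ trans (+-identityˡ _) (*-identityˡ (c (suc M))) ⟩
  c (suc M) ∎

conv-zero : ∀ c a b → conv c 0 a ≡ conv c 0 b
conv-zero c a b = cong (_* c 0) (trans (bin-n-0 a) (sym (bin-n-0 b)))

-- Multiplication of the series by 1+t. Read as a difference in `a`, it says that differencing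
-- lowers `M` by one.
conv-suc : ∀ c M a → conv c (suc M) (suc a) ≡ conv c (suc M) a + conv c M a
conv-suc c M a = begin
  Σ≤ M (λ n → bin (suc a) (suc M ∸ n) * c n) + bin (suc a) (M ∸ M) * c (suc M)
    ≡⟨ cong₂ _+_ (trans (Σ≤-cong M split) (Σ≤-+ M _ _)) (cong (_* c (suc M)) top) ⟩
  (conv c M a + Σ≤ M (λ n → bin a (suc M ∸ n) * c n)) + bin a (M ∸ M) * c (suc M)
    ≡⟨ rearrange (conv c M a) _ _ ⟩
  conv c (suc M) a + conv c M a ∎
  where
  split : ∀ {n} → n ≤ M → bin (suc a) (suc M ∸ n) * c n ≡ bin a (M ∸ n) * c n + bin a (suc M ∸ n) * c n
  split {n} n≤M rewrite ℕₚ.+-∸-assoc 1 n≤M =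
    trans (cong (_* c n) (bin-pascal a (M ∸ n))) (*-distribʳ-+ (c n) (bin a (M ∸ n)) (bin a (suc (M ∸ n))))
  -- At n = M+1 the lower index is 0, outside the reach of Pascal's rule as used in `split`.
  top : bin (suc a) (M ∸ M) ≡ bin a (M ∸ M)
  top rewrite ℕₚ.n∸n≡0 M = trans (bin-n-0 (suc a)) (sym (bin-n-0 a))
  rearrange : ∀ a b c → (a + b) + c ≡ (b + c) + a
  rearrange = solve-∀ ℚ-ring

-- Each of the `N` differences lowers the degree by one, and at exponent 0 only the coefficient
-- `c d` is left.
T-signed-conv-≤ : ∀ c N d → T (signed (conv c (N +ℕ d))) N ≡ sgn N * c d
T-signed-conv-≤ c zero    d = trans (*-identityˡ (1ℚ * conv c d 0)) (cong (1ℚ *_) (conv-0 c d))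
T-signed-conv-≤ c (suc N) d = begin
  T (signed (conv c (suc N +ℕ d))) (suc N)  ≡⟨ T-signed-suc _ _ (conv-suc c (N +ℕ d)) N ⟩
  - T (signed (conv c (N +ℕ d))) N          ≡⟨ cong -_ (T-signed-conv-≤ c N d) ⟩
  - (sgn N * c d)                           ≡⟨ neg-distribˡ-* (sgn N) (c d) ⟩
  (- sgn N) * c d                           ∎

-- After `M` differences the sequence is constant in the exponent, and the next difference kills it.
T-signed-conv-> : ∀ c M d → T (signed (conv c M)) (suc (M +ℕ d)) ≡ 0ℚ
T-signed-conv-> c zero d = trans
  (T-signed-suc (conv c 0) (λ _ → 0ℚ) (λ a → trans (conv-zero c (suc a) a) (sym (+-identityʳ _))) d)
  (cong -_ (Σ≤-zero d (λ {j} _ → trans (cong (bin d j *_) (*-zeroʳ (sgn j))) (*-zeroʳ (bin d j)))))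
T-signed-conv-> c (suc M) d =
  trans (T-signed-suc _ _ (conv-suc c M) (suc (M +ℕ d))) (cong -_ (T-signed-conv-> c M d))

-- coefficients of the umbral series (1 - 𝐁t)^{-(p+1)}
bernCoeff : ℕ → ℕ → ℚ
bernCoeff p n = bin (n +ℕ p) n * B n

-- At this exponent trinomial revision pulls one common binomial out of every term. It supplies the
-- far endpoint for the case a = 0 of the reflection.
bernConv-top : ∀ p M → conv (bernCoeff p) M (M +ℕ p) ≡ bin (M +ℕ p) M * T B M
bernConv-top p M = trans (Σ≤-cong M term) (Σ≤-*ˡ M (bin (M +ℕ p) M) _)
  where
  revision : ∀ n e → bin (n +ℕ e +ℕ p) e * bin (n +ℕ p) n ≡ bin (n +ℕ e +ℕ p) (n +ℕ e) * bin (n +ℕ e) n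
  revision n e = trans (sym (ℕtoℚ-* ((n +ℕ e +ℕ p) C e) ((n +ℕ p) C n)))
    (trans (cong ℕtoℚ (trinomial-revision n e p)) (ℕtoℚ-* ((n +ℕ e +ℕ p) C (n +ℕ e)) ((n +ℕ e) C n)))
  term : ∀ {n} → n ≤ M → bin (M +ℕ p) (M ∸ n) * (bin (n +ℕ p) n * B n) ≡ bin (M +ℕ p) M * (bin M n * B n)
  term {n} n≤M = begin
    bin (M +ℕ p) (M ∸ n) * (bin (n +ℕ p) n * B n)   ≡⟨ *-assoc (bin (M +ℕ p) (M ∸ n)) _ _ ⟨
    bin (M +ℕ p) (M ∸ n) * bin (n +ℕ p) n * B n     ≡⟨ cong (_* B n) (subst (λ k → bin (k +ℕ p) (M ∸ n) * bin (n +ℕ p) n ≡ bin (k +ℕ p) k * bin k n) (ℕₚ.m+[n∸m]≡n n≤M) (revision n (M ∸ n))) ⟩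
    bin (M +ℕ p) M * bin M n * B n                  ≡⟨ *-assoc (bin (M +ℕ p) M) _ _ ⟩
    bin (M +ℕ p) M * (bin M n * B n)                ∎

-- This is the substitution t ↦ -t/(1+t) in the residue of
-- (1+t)ᵃ (1-𝐁t)^{-(p+1)} / t^{M+1}; Pascal's rule reduces it to a = 0.
bernConv-reflect : ∀ p M a b → a +ℕ b ≡ M +ℕ p →
  conv (bernCoeff p) M a ≡ sgn M * conv (bernCoeff p) M b
bernConv-reflect p M zero .(M +ℕ p) refl = begin
  conv (bernCoeff p) M 0                   ≡⟨ conv-0 (bernCoeff p) M ⟩
  bin (M +ℕ p) M * B M                     ≡⟨ cong (bin (M +ℕ p) M *_) (signed-T-B M) ⟨
  bin (M +ℕ p) M * (sgn M * T B M)         ≡⟨ rearrange (bin (M +ℕ p) M) (sgn M) (T B M) ⟩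
  sgn M * (bin (M +ℕ p) M * T B M)         ≡⟨ cong (sgn M *_) (bernConv-top p M) ⟨
  sgn M * conv (bernCoeff p) M (M +ℕ p)    ∎
  where
  rearrange : ∀ a b c → a * (b * c) ≡ b * (a * c)
  rearrange = solve-∀ ℚ-ring
bernConv-reflect p zero (suc a) b e =
  trans (conv-zero (bernCoeff p) (suc a) b) (sym (*-identityˡ (conv (bernCoeff p) 0 b)))
bernConv-reflect p (suc M) (suc a) b e = begin
  F (suc M) (suc a)                                     ≡⟨ conv-suc (bernCoeff p) M a ⟩
  -- In the first term `b` rises as `a` falls, so the sum of exponents still fits `suc M`; in the
  -- second the sum drops by one together with the degree.
  F (suc M) a + F M a                                   ≡⟨ cong₂ _+_ (bernConv-reflect p (suc M) a (suc b) (trans (ℕₚ.+-suc a b) e))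
                                                                     (bernConv-reflect p M a b (ℕₚ.suc-injective e)) ⟩
  (- sgn M) * F (suc M) (suc b) + sgn M * F M b         ≡⟨ cong (λ t → (- sgn M) * t + sgn M * F M b) (conv-suc (bernCoeff p) M b) ⟩
  (- sgn M) * (F (suc M) b + F M b) + sgn M * F M b     ≡⟨ cancel (sgn M) (F (suc M) b) (F M b) ⟩
  (- sgn M) * F (suc M) b                               ∎
  where
  F = conv (bernCoeff p)
  cancel : ∀ s x y → (- s) * (x + y) + s * y ≡ (- s) * x
  cancel = solve-∀ ℚ-ring

-- The matrices

-- The extracted coefficient has index M - N, here odd and at least 3, so its Bernoulli factor is
-- zero.
T-bernConv-< : ∀ p N o {M} → M ≡ N +ℕ suc (2 *ℕ suc o) → T (signed (conv (bernCoeff p) M)) N ≡ 0ℚ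
T-bernConv-< p N o refl = begin
  T (signed (conv (bernCoeff p) (N +ℕ n))) N   ≡⟨ T-signed-conv-≤ (bernCoeff p) N n ⟩
  sgn N * (bin (n +ℕ p) n * B n)               ≡⟨ cong (λ t → sgn N * (bin (n +ℕ p) n * t)) (B-odd o) ⟩
  sgn N * (bin (n +ℕ p) n * 0ℚ)                ≡⟨ cong (sgn N *_) (*-zeroʳ (bin (n +ℕ p) n)) ⟩
  sgn N * 0ℚ                                   ≡⟨ *-zeroʳ (sgn N) ⟩
  0ℚ                                           ∎
  where n = suc (2 *ℕ suc o)

T-bernConv-> : ∀ p M d {N} → N ≡ suc (M +ℕ d) → T (signed (conv (bernCoeff p) M)) N ≡ 0ℚ
T-bernConv-> p M d refl = T-signed-conv-> (bernCoeff p) M d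

≢⇒difference : ∀ {e f} → e ≢ f → (∃ λ o → suc e +ℕ o ≡ f) ⊎ (∃ λ o → suc f +ℕ o ≡ e)
≢⇒difference {e} {f} e≢f with ℕₚ.<-cmp e f
... | tri< e<f _ _ = inj₁ (ℕₚ.m≤n⇒∃[o]m+o≡n e<f)
... | tri≈ _ e≡f _ = contradiction e≡f e≢f
... | tri> _ _ f<e = inj₂ (ℕₚ.m≤n⇒∃[o]m+o≡n f<e)

-- Here M - N = 2(f-e)+1: for e < f it is an odd number at least 3, for e > f it is negative. Only e
-- = f would reach B₁.
T-bernConv-off-diagonal : ∀ p e f → e ≢ f →
  T (signed (conv (bernCoeff p) (suc (2 *ℕ suc f)))) (2 *ℕ suc e) ≡ 0ℚ
T-bernConv-off-diagonal p e f e≢f = [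
    (λ { (o , eq) → T-bernConv-< p (2 *ℕ suc e) o (trans (cong (λ t → suc (2 *ℕ suc t)) (sym eq)) (index-< e o)) }) ,
    (λ { (o , eq) → T-bernConv-> p (suc (2 *ℕ suc f)) (2 *ℕ o) (trans (cong (λ t → 2 *ℕ suc t) (sym eq)) (index-> f o)) })
  ]′ (≢⇒difference e≢f)
  where
  index-< : ∀ e o → suc (2 *ℕ suc (suc e +ℕ o)) ≡ 2 *ℕ suc e +ℕ suc (2 *ℕ suc o)
  index-< = ℕ-solve-∀
  index-> : ∀ f o → 2 *ℕ suc (suc f +ℕ o) ≡ suc (suc (2 *ℕ suc f) +ℕ 2 *ℕ o)
  index-> = ℕ-solve-∀

-- The left side is minus the signed sum over the exponents 1, ..., 2n+2; `G 0` compensates for the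
-- term at 0.
alternating-pairs : ∀ (G : ℕ → ℚ) n →
  Σ≤ n (λ r → G (suc (2 *ℕ r)) - G (2 *ℕ suc r)) ≡ G 0 - Σ≤ (2 *ℕ suc n) (signed G)
alternating-pairs G zero    = pair (G 0) (G 1) (G 2)
  where
  pair : ∀ a b c → b - c ≡ a - ((1ℚ * a + (- 1ℚ) * b) + (- (- 1ℚ)) * c)
  pair = solve-∀ ℚ-ring
alternating-pairs G (suc n) = trans
  (cong (_+ (G (suc (2 *ℕ suc n)) - G (2 *ℕ suc (suc n)))) (alternating-pairs G n))
  (next-pair (2 *ℕ suc n) (ℕₚ.*-suc 2 (suc n)) (sgn-even (suc n)))
  where
  pair : ∀ a S b c → (a - S) + (b - c) ≡ a - ((S + (- 1ℚ) * b) + (- (- 1ℚ)) * c)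
  pair = solve-∀ ℚ-ring
  -- The upper bound is abstracted to `t′` so that matching on its equation unfolds two terms of
  -- `Σ≤`.
  next-pair : ∀ t {t′} → t′ ≡ suc (suc t) → sgn t ≡ 1ℚ →
    (G 0 - Σ≤ t (signed G)) + (G (suc t) - G t′) ≡ G 0 - Σ≤ t′ (signed G)
  next-pair t refl even = trans (pair (G 0) (Σ≤ t (signed G)) (G (suc t)) (G (suc (suc t))))
    (cong (λ s → G 0 - ((Σ≤ t (signed G) + (- s) * G (suc t)) + (- (- s)) * G (suc (suc t)))) (sym even))

2[1+v]∸1 : ∀ v → 2 *ℕ suc v ∸ 1 ≡ suc (2 *ℕ v)
2[1+v]∸1 v = cong (_∸ 1) (ℕₚ.*-suc 2 v)

-- The sum shared by `Dmat₁` and `Dmat₂` with its upper index left free, spelled as there so that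
-- both unfold to it.
bernSum : ℕ → ℕ → ℕ → ℚ
bernSum v M a = Σ≤ M (λ n → ℕtoℚ (a C (M ∸ n)) * ℕtoℚ ((n +ℕ 2 *ℕ suc v ∸ 2) C n) * B n)

bernSum≡conv : ∀ v M a → bernSum v M a ≡ conv (bernCoeff (2 *ℕ v)) M a
bernSum≡conv v M a = Σ≤-cong M (λ {n} _ →
  trans (*-assoc (bin a (M ∸ n)) (bin (n +ℕ 2 *ℕ suc v ∸ 2) n) (B n))
        (cong (λ t → bin a (M ∸ n) * (bin t n * B n)) (shift n)))
  where
  shift : ∀ n → n +ℕ 2 *ℕ suc v ∸ 2 ≡ n +ℕ 2 *ℕ v
  shift n = trans (cong (λ t → n +ℕ t ∸ 2) (ℕₚ.*-suc 2 v)) (ℕₚ.+-∸-assoc n (ℕₚ.m≤m+n 2 (2 *ℕ v)))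

-- With K = m+2 the size `K ∸ 1` computes to `suc m`. For s = v+1 the number K-s is `suc (m ∸ v)`,
-- the form used for all indices below.
module _ (m : ℕ) where

  private
    K = suc (suc m)

  2K∸2[1+v] : ∀ {v} → v ≤ m → 2 *ℕ K ∸ 2 *ℕ suc v ≡ 2 *ℕ suc (m ∸ v)
  2K∸2[1+v] {v} v≤m =
    trans (sym (ℕₚ.*-distribˡ-∸ 2 K (suc v))) (cong (2 *ℕ_) (ℕₚ.+-∸-assoc 1 v≤m))

  k∸2[1+v] : ∀ {v} → v ≤ m → suc (2 *ℕ K) ∸ 2 *ℕ suc v ≡ suc (2 *ℕ suc (m ∸ v))
  k∸2[1+v] v≤m =
    trans (ℕₚ.+-∸-assoc 1 (ℕₚ.*-monoʳ-≤ 2 (ℕₚ.m≤n⇒m≤1+n (s≤s v≤m)))) (cong suc (2K∸2[1+v] v≤m))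

  toℕ≤m : (i : Fin (suc m)) → toℕ i ≤ m
  toℕ≤m = Finₚ.toℕ≤pred[n]

  -- column v a is F(a) for s = v + 1 (indices of the matrices start at 0).
  column : ℕ → ℕ → ℚ
  column v = conv (bernCoeff (2 *ℕ v)) (suc (2 *ℕ suc (m ∸ v)))

  bernSum≡column : ∀ {v a a′} → v ≤ m → a ≡ a′ → bernSum v (suc (2 *ℕ K) ∸ 2 *ℕ suc v) a ≡ column v a′
  bernSum≡column {v} {a} v≤m refl =
    trans (cong (λ M → bernSum v M a) (k∸2[1+v] v≤m)) (bernSum≡conv v (suc (2 *ℕ suc (m ∸ v))) a)

  scale : ℕ → ℚ
  scale v = ℤ.+ 2 / suc (2 *ℕ v)

  Dmat₁-column : ∀ r s → Dmat₁ K r s ≡ (- scale (toℕ s)) * column (toℕ s) (2 *ℕ suc (m ∸ toℕ r))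
  -- A quotient with numerator -2 unfolds to the negative of the one with numerator 2, so the
  -- prefactor is `- scale` by computation.
  Dmat₁-column r s = cong ((- scale (toℕ s)) *_)
    (bernSum≡column (toℕ≤m s) (cong (_∸ 1) (k∸2[1+v] (toℕ≤m r))))

  Dmat₂-column : ∀ r s → Dmat₂ K r s ≡ scale (toℕ s) * column (toℕ s) (suc (2 *ℕ toℕ r))
  Dmat₂-column r s = cong (scale (toℕ s) *_)
    (bernSum≡column (toℕ≤m s) (2[1+v]∸1 (toℕ r)))

  Cmat-bin : ∀ s r → Cmat K s r ≡
    bin (2 *ℕ suc (m ∸ toℕ s)) (suc (2 *ℕ toℕ r)) + bin (2 *ℕ suc (m ∸ toℕ s)) (2 *ℕ suc (m ∸ toℕ r))
  Cmat-bin s r = trans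
    (ℕtoℚ-+ ((2 *ℕ K ∸ 2 *ℕ idx s) C (2 *ℕ idx r ∸ 1)) ((2 *ℕ K ∸ 2 *ℕ idx s) C (2 *ℕ K ∸ 2 *ℕ idx r)))
    (cong₂ _+_ (cong₂ bin (2K∸2[1+v] (toℕ≤m s)) (2[1+v]∸1 (toℕ r)))
               (cong₂ bin (2K∸2[1+v] (toℕ≤m s)) (2K∸2[1+v] (toℕ≤m r))))

  -- The exponents 2r-1 and 2K-2r (with r counted from 1) add up to 2K-1, which is M+p for M = k-2s
  -- and p = 2s-2. As M is odd, the reflection carries a minus sign.
  column-reflect : ∀ {r v} → r ≤ m → v ≤ m → column v (suc (2 *ℕ r)) ≡ - column v (2 *ℕ suc (m ∸ r))
  column-reflect {r} {v} r≤m v≤m = begin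
    column v (suc (2 *ℕ r))
      ≡⟨ bernConv-reflect (2 *ℕ v) (suc (2 *ℕ suc (m ∸ v))) (suc (2 *ℕ r)) (2 *ℕ suc (m ∸ r)) index ⟩
    sgn (suc (2 *ℕ suc (m ∸ v))) * column v (2 *ℕ suc (m ∸ r))
      ≡⟨ cong (_* column v (2 *ℕ suc (m ∸ r))) (sgn-odd (suc (m ∸ v))) ⟩
    (- 1ℚ) * column v (2 *ℕ suc (m ∸ r))
      ≡⟨ neg-one _ ⟩
    - column v (2 *ℕ suc (m ∸ r)) ∎
    where
    neg-one : ∀ a → (- 1ℚ) * a ≡ - a
    neg-one = solve-∀ ℚ-ring
    regroupˡ : ∀ r d → suc (2 *ℕ r) +ℕ 2 *ℕ suc d ≡ 3 +ℕ 2 *ℕ (r +ℕ d)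
    regroupˡ = ℕ-solve-∀
    regroupʳ : ∀ v d → suc (2 *ℕ suc d) +ℕ 2 *ℕ v ≡ 3 +ℕ 2 *ℕ (v +ℕ d)
    regroupʳ = ℕ-solve-∀
    index : suc (2 *ℕ r) +ℕ 2 *ℕ suc (m ∸ r) ≡ suc (2 *ℕ suc (m ∸ v)) +ℕ 2 *ℕ v
    index = begin
      suc (2 *ℕ r) +ℕ 2 *ℕ suc (m ∸ r)    ≡⟨ regroupˡ r (m ∸ r) ⟩
      3 +ℕ 2 *ℕ (r +ℕ (m ∸ r))            ≡⟨ cong (λ t → 3 +ℕ 2 *ℕ t) (trans (ℕₚ.m+[n∸m]≡n r≤m) (sym (ℕₚ.m+[n∸m]≡n v≤m))) ⟩
      3 +ℕ 2 *ℕ (v +ℕ (m ∸ v))            ≡⟨ regroupʳ v (m ∸ v) ⟨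
      suc (2 *ℕ suc (m ∸ v)) +ℕ 2 *ℕ v    ∎

  Dmat₁≡Dmat₂ : ∀ r s → Dmat₁ K r s ≡ Dmat₂ K r s
  Dmat₁≡Dmat₂ r s = begin
    Dmat₁ K r s                                                         ≡⟨ Dmat₁-column r s ⟩
    (- scale (toℕ s)) * column (toℕ s) (2 *ℕ suc (m ∸ toℕ r))           ≡⟨ move-neg (scale (toℕ s)) _ ⟩
    scale (toℕ s) * (- column (toℕ s) (2 *ℕ suc (m ∸ toℕ r)))           ≡⟨ cong (scale (toℕ s) *_) (column-reflect (toℕ≤m r) (toℕ≤m s)) ⟨
    scale (toℕ s) * column (toℕ s) (suc (2 *ℕ toℕ r))                   ≡⟨ Dmat₂-column r s ⟨
    Dmat₂ K r s                                                         ∎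
    where
    move-neg : ∀ a b → (- a) * b ≡ a * (- b)
    move-neg = solve-∀ ℚ-ring

  -- The first binomial of `Cmat` is paired with F(2r-1), the second, by reflection, with -F(2K-2r).
  -- Together they run once through the exponents 1, ..., 2K-2 with alternating signs.
  CD-sum : ∀ i j → (Cmat K ⊗ Dmat₁ K) i j ≡
    scale (toℕ j) * (- T (signed (column (toℕ j))) (2 *ℕ suc (m ∸ toℕ i)))
  CD-sum i j = begin
    ΣF (suc m) (λ l → Cmat K i l * Dmat₁ K l j)
      ≡⟨ ΣF-cong (suc m) (λ l → trans (cong₂ _*_ (Cmat-bin i l) (trans (Dmat₁≡Dmat₂ l j) (Dmat₂-column l j))) (term (toℕ≤m l))) ⟩
    ΣF (suc m) (λ l → w * (G (suc (2 *ℕ toℕ l)) + (- G (2 *ℕ suc (m ∸ toℕ l)))))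
      ≡⟨ ΣF≡Σ≤ m (λ r → w * (G (suc (2 *ℕ r)) + (- G (2 *ℕ suc (m ∸ r))))) ⟩
    Σ≤ m (λ r → w * (G (suc (2 *ℕ r)) + (- G (2 *ℕ suc (m ∸ r)))))
      ≡⟨ Σ≤-*ˡ m w _ ⟩
    w * Σ≤ m (λ r → G (suc (2 *ℕ r)) + (- G (2 *ℕ suc (m ∸ r))))
      ≡⟨ cong (w *_) sum ⟩
    w * (- T (signed F) N) ∎
    where
    u = toℕ i
    v = toℕ j
    w = scale v
    N = 2 *ℕ suc (m ∸ u)
    F = column v
    G : ℕ → ℚ
    G a = bin N a * F a
    distribute : ∀ x y w f f′ → f ≡ - f′ → (x + y) * (w * f) ≡ w * (x * f + (- (y * f′)))
    distribute x y w .(- f′) f′ refl = expand x y w f′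
      where
      expand : ∀ x y w f → (x + y) * (w * (- f)) ≡ w * (x * (- f) + (- (y * f)))
      expand = solve-∀ ℚ-ring
    term : ∀ {r} → r ≤ m →
      (bin N (suc (2 *ℕ r)) + bin N (2 *ℕ suc (m ∸ r))) * (w * F (suc (2 *ℕ r)))
      ≡ w * (G (suc (2 *ℕ r)) + (- G (2 *ℕ suc (m ∸ r))))
    term {r} r≤m = distribute (bin N (suc (2 *ℕ r))) (bin N (2 *ℕ suc (m ∸ r))) w
      (F (suc (2 *ℕ r))) (F (2 *ℕ suc (m ∸ r))) (column-reflect r≤m (toℕ≤m j))
    -- F(0) is a multiple of the Bernoulli number of index k-2s, which is odd and at least 3 because
    -- s ≤ K-1.
    G0≡0 : G 0 ≡ 0ℚ
    G0≡0 = begin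
      bin N 0 * F 0                        ≡⟨ cong (bin N 0 *_) (conv-0 (bernCoeff (2 *ℕ v)) (suc (2 *ℕ suc (m ∸ v)))) ⟩
      bin N 0 * (b * B (suc (2 *ℕ suc (m ∸ v)))) ≡⟨ cong (λ t → bin N 0 * (b * t)) (B-odd (m ∸ v)) ⟩
      bin N 0 * (b * 0ℚ)                   ≡⟨ cong (bin N 0 *_) (*-zeroʳ b) ⟩
      bin N 0 * 0ℚ                         ≡⟨ *-zeroʳ (bin N 0) ⟩
      0ℚ ∎
      where b = bin (suc (2 *ℕ suc (m ∸ v)) +ℕ 2 *ℕ v) (suc (2 *ℕ suc (m ∸ v)))
    swap : ∀ a b c → a * (b * c) ≡ b * (a * c)
    swap = solve-∀ ℚ-ring
    -- Every row runs up to 2K-2, whereas `T` stops at `N`; the surplus of 2u terms has zero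
    -- binomials.
    range : 2 *ℕ u +ℕ N ≡ 2 *ℕ suc m
    range = trans (sym (ℕₚ.*-distribˡ-+ 2 u (suc (m ∸ u))))
      (cong (2 *ℕ_) (trans (ℕₚ.+-suc u (m ∸ u)) (cong suc (ℕₚ.m+[n∸m]≡n (toℕ≤m i)))))
    alternating : Σ≤ (2 *ℕ suc m) (signed G) ≡ T (signed F) N
    alternating = begin
      Σ≤ (2 *ℕ suc m) (signed G)
        ≡⟨ Σ≤-cong (2 *ℕ suc m) (λ {a} _ → swap (sgn a) (bin N a) (F a)) ⟩
      Σ≤ (2 *ℕ suc m) (λ a → bin N a * signed F a)
        ≡⟨ cong (λ t → Σ≤ t (λ a → bin N a * signed F a)) range ⟨
      Σ≤ (2 *ℕ u +ℕ N) (λ a → bin N a * signed F a)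
        ≡⟨ Σ≤-extend N (2 *ℕ u) _ (λ {a} N<a → trans (cong (_* signed F a) (bin-> N<a)) (*-zeroˡ (signed F a))) ⟩
      T (signed F) N ∎
    sum : Σ≤ m (λ r → G (suc (2 *ℕ r)) + (- G (2 *ℕ suc (m ∸ r)))) ≡ - T (signed F) N
    sum = begin
      Σ≤ m (λ r → G (suc (2 *ℕ r)) + (- G (2 *ℕ suc (m ∸ r))))
        ≡⟨ Σ≤-+ m (λ r → G (suc (2 *ℕ r))) (λ r → - G (2 *ℕ suc (m ∸ r))) ⟩
      Σ≤ m (λ r → G (suc (2 *ℕ r))) + Σ≤ m (λ r → - G (2 *ℕ suc (m ∸ r)))
        -- Reversal lists the even exponents 2K-2r in increasing order, next to the odd ones.
        ≡⟨ cong (Σ≤ m (λ r → G (suc (2 *ℕ r))) +_) (Σ≤-reverse m (λ r → - G (2 *ℕ suc r))) ⟩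
      Σ≤ m (λ r → G (suc (2 *ℕ r))) + Σ≤ m (λ r → - G (2 *ℕ suc r))
        ≡⟨ Σ≤-+ m (λ r → G (suc (2 *ℕ r))) (λ r → - G (2 *ℕ suc r)) ⟨
      Σ≤ m (λ r → G (suc (2 *ℕ r)) - G (2 *ℕ suc r))
        ≡⟨ alternating-pairs G m ⟩
      G 0 - Σ≤ (2 *ℕ suc m) (signed G)
        ≡⟨ cong₂ _-_ G0≡0 alternating ⟩
      0ℚ - T (signed F) N
        ≡⟨ +-identityˡ _ ⟩
      - T (signed F) N ∎

  -- On the diagonal M - N = 1, so the extracted coefficient is (2v+1)B₁. The factor 2/(2v+1) and
  -- the sign then give -2B₁ = 1.
  T-column-diagonal : ∀ v → scale v * (- T (signed (column v)) (2 *ℕ suc (m ∸ v))) ≡ 1ℚ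
  T-column-diagonal v = begin
    scale v * (- T (signed (column v)) N)
      ≡⟨ cong (λ M → scale v * (- T (signed (conv c M)) N)) (ℕₚ.+-comm 1 N) ⟩
    scale v * (- T (signed (conv c (N +ℕ 1))) N)
      ≡⟨ cong (λ t → scale v * (- t)) (T-signed-conv-≤ c N 1) ⟩
    scale v * (- (sgn N * (bin (suc (2 *ℕ v)) 1 * B 1)))
      ≡⟨ cong₂ (λ s t → scale v * (- (s * (t * B 1)))) (sgn-even (suc (m ∸ v))) (cong ℕtoℚ (nC1≡n (suc (2 *ℕ v)))) ⟩
    scale v * (- (1ℚ * (ℕtoℚ (suc (2 *ℕ v)) * B 1)))
      ≡⟨ rearrange (scale v) (ℕtoℚ (suc (2 *ℕ v))) (B 1) ⟩
    (scale v * ℕtoℚ (suc (2 *ℕ v))) * (- B 1)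
      ≡⟨ cong (_* (- B 1)) (/-*-cancel 2 (2 *ℕ v)) ⟩
    1ℚ ∎
    where
    N = 2 *ℕ suc (m ∸ v)
    c = bernCoeff (2 *ℕ v)
    rearrange : ∀ a b d → a * (- (1ℚ * (b * d))) ≡ (a * b) * (- d)
    rearrange = solve-∀ ℚ-ring

  CD≡Id : ∀ i j → (Cmat K ⊗ Dmat₁ K) i j ≡ Id i j
  CD≡Id i j = by-cases (i Fin.≟ j)
    where
    by-cases : Dec (i ≡ j) → (Cmat K ⊗ Dmat₁ K) i j ≡ Id i j
    by-cases (yes refl) = begin
      (Cmat K ⊗ Dmat₁ K) i i   ≡⟨ CD-sum i i ⟩
      scale (toℕ i) * (- T (signed (column (toℕ i))) (2 *ℕ suc (m ∸ toℕ i))) ≡⟨ T-column-diagonal (toℕ i) ⟩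
      1ℚ                       ≡⟨ Id-diagonal i ⟨
      Id i i                   ∎
    by-cases (no i≢j) = begin
      (Cmat K ⊗ Dmat₁ K) i j   ≡⟨ CD-sum i j ⟩
      scale (toℕ j) * (- T (signed (column (toℕ j))) (2 *ℕ suc (m ∸ toℕ i)))
        ≡⟨ cong (λ t → scale (toℕ j) * (- t)) (T-bernConv-off-diagonal (2 *ℕ toℕ j) (m ∸ toℕ i) (m ∸ toℕ j) distinct) ⟩
      scale (toℕ j) * 0ℚ       ≡⟨ *-zeroʳ (scale (toℕ j)) ⟩
      0ℚ                       ≡⟨ Id-off-diagonal i≢j ⟨
      Id i j                   ∎
      where
      distinct : m ∸ toℕ i ≢ m ∸ toℕ j
      distinct e = i≢j (Finₚ.toℕ-injective (ℕₚ.∸-cancelˡ-≡ (toℕ≤m i) (toℕ≤m j) e))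

theorem1 : (K : ℕ) → 2 ≤ K →
    ((∀ (i j : Fin (K ∸ 1)) → (Cmat K ⊗ Dmat₁ K) i j ≡ Id i j)
    × (∀ (i j : Fin (K ∸ 1)) → (Dmat₁ K ⊗ Cmat K) i j ≡ Id i j))
    × (∀ (r s : Fin (K ∸ 1)) → Dmat₁ K r s ≡ Dmat₂ K r s)
theorem1 (suc zero) (s≤s ())
theorem1 (suc (suc m)) _ =
  (CD≡Id m , leftInverse⇒rightInverse (Cmat (suc (suc m))) (Dmat₁ (suc (suc m))) (CD≡Id m)) , Dmat₁≡Dmat₂ m
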